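{- Let $A$ be an ITL-NL formula and $p$ be a propositional variable. Then $\exists p\,A$ is equivalent to an ITL-NL formula, i.e. there is an ITL-NL formula $A'$ such that for all $\sigma:\mathbb Z\to\Sigma$ and all integers $i\le j$: $\sigma,i,j\models A'$ iff $\sigma,i,j\models\exists p\,A$.
   Context: $V$ is a vocabulary of propositional variables and $\Sigma=\mathcal P(V)$. ITL-NL formulas (which do not include quantifiers): $A::=\bot\mid q\mid A\supset A\mid\bigcirc A\mid A;A\mid A^*\mid\Diamond_l A\mid\Diamond_r A$, with $q\in V$. For $\sigma:\mathbb Z\to\Sigma$ and integers $i\le j$: $\sigma,i,j\not\models\bot$; $\sigma,i,j\models q$ iff $q\in\sigma^i$; $\sigma,i,j\models A\supset B$ iff $\sigma,i,j\not\models A$ or $\sigma,i,j\models B$; $\sigma,i,j\models\bigcirc A$ iff $i<j$ and $\sigma,i+1,j\models A$; $\sigma,i,j\models A;B$ iff $\sigma,i,k\models A$ and $\sigma,k,j\models B$ for some $k\in\{i,\ldots,j\}$; $\sigma,i,j\models A^*$ iff $i=j$ or there are $k_0=i<k_1<\cdots<k_N=j$ with $\sigma,k_{n-1},k_n\models A$ for $n=1,\ldots,N$; $\sigma,i,j\models\Diamond_l A$ iff $\sigma,k,i\models A$ for some $k\le i$; $\sigma,i,j\models\Diamond_r A$ iff $\sigma,j,k\models A$ for some $k\ge j$. Propositional quantification: $\sigma,i,j\models\exists p\,A$ iff there exists $\sigma':\mathbb Z\to\Sigma$ with $\sigma'\sim_p\sigma$ and $\sigma',i,j\models A$, where $\sigma'\sim_p\sigma$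 means $\sigma^k\setminus\{p\}=\sigma'^k\setminus\{p\}$ for all $k\in\mathbb Z$. -}

module Defs where

open import Data.Empty using (⊥)
open import Data.Fin.Base using (Fin; zero; suc; inject₁; fromℕ)
open import Data.Integer.Base using (ℤ; _≤_; _<_; _+_; 1ℤ)
open import Data.Nat.Base using (suc)
open import Data.Product.Base using (_×_; ∃-syntax; Σ-syntax)
open import Data.Sum.Base using (_⊎_)
open import Level using (0ℓ)
open import Relation.Binary.PropositionalEquality.Core using (_≡_)
open import Relation.Nullary.Negation.Core using (¬_)
open import Relation.Unary using (Pred; _∈_; _∖_; ｛_｝; _≐_)

infix  30 _✶
infixr 25 ○_ ◇ₗ_ ◇ᵣ_
infixr 20 _⨟_
infixr 15 _⊃_

data Formula (V : Set) : Set where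
  ⊥′   : Formula V
  var  : V → Formula V
  _⊃_  : Formula V → Formula V → Formula V
  ○_   : Formula V → Formula V
  _⨟_  : Formula V → Formula V → Formula V
  _✶   : Formula V → Formula V
  ◇ₗ_  : Formula V → Formula V
  ◇ᵣ_  : Formula V → Formula V

Model : Set → Set₁
Model V = ℤ → Pred V 0ℓ

infix 4 _⟨_⋯_⟩⊨_ _⟨_⋯_⟩⊨∃[_]_

-- Defined for all i and j, but meant for i ≤ j only; every clause stays
-- within i ≤ j.
_⟨_⋯_⟩⊨_ : {V : Set} → Model V → ℤ → ℤ → Formula V → Set
σ ⟨ i ⋯ j ⟩⊨ ⊥′      = ⊥
σ ⟨ i ⋯ j ⟩⊨ var q   = q ∈ σ i
σ ⟨ i ⋯ j ⟩⊨ A ⊃ B   = ¬ (σ ⟨ i ⋯ j ⟩⊨ A) ⊎ σ ⟨ i ⋯ j ⟩⊨ B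
σ ⟨ i ⋯ j ⟩⊨ ○ A     = i < j × σ ⟨ i + 1ℤ ⋯ j ⟩⊨ A
σ ⟨ i ⋯ j ⟩⊨ A ⨟ B   =
  ∃[ k ] (i ≤ k × k ≤ j) × σ ⟨ i ⋯ k ⟩⊨ A × σ ⟨ k ⋯ j ⟩⊨ B
σ ⟨ i ⋯ j ⟩⊨ A ✶     =
  i ≡ j ⊎
  (∃[ N ] Σ[ k ∈ (Fin (suc N) → ℤ) ]
    k zero ≡ i × k (fromℕ N) ≡ j ×
    ((n : Fin N) → k (inject₁ n) < k (suc n) ×
                   σ ⟨ k (inject₁ n) ⋯ k (suc n) ⟩⊨ A))
σ ⟨ i ⋯ j ⟩⊨ ◇ₗ A    = ∃[ k ] k ≤ i × σ ⟨ k ⋯ i ⟩⊨ A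
σ ⟨ i ⋯ j ⟩⊨ ◇ᵣ A    = ∃[ k ] j ≤ k × σ ⟨ j ⋯ k ⟩⊨ A

_∼[_]_ : {V : Set} → Model V → V → Model V → Set
σ′ ∼[ p ] σ = ∀ k → σ k ∖ ｛ p ｝ ≐ σ′ k ∖ ｛ p ｝

_⟨_⋯_⟩⊨∃[_]_ : {V : Set} → Model V → ℤ → ℤ → V → Formula V → Set₁
σ ⟨ i ⋯ j ⟩⊨∃[ p ] A = ∃[ σ′ ] σ′ ∼[ p ] σ × σ′ ⟨ i ⋯ j ⟩⊨ A

{-# OPTIONS --safe #-}
module Submission where

-- Büchi's argument on ℤ-indexed words. A language of bi-infinite words is
-- regular if it is invariant under replacing the blocks of some cutting by
-- blocks congruent modulo a finite-index congruence. Such languages are closed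
-- under complement, intersection and projection (glue relabelled blocks), so
-- { (σ, i, j) : σ, i, j ⊨ A } is regular, by induction on A, and stays regular
-- under ∃ p. Conversely the colour of [i, j) is ITL-definable by Kleene's
-- algorithm. The future of j can be cut into blocks of colours s, e, e, …;
-- following Shelah, a sufficient condition for this is that some k ≥ j, with
-- [j, k) of colour s, merges with cofinally many x such that [k, x) has colour
-- e, and this condition uses only ◇ᵣ and colours of intervals. Some pair (s , e)
-- always satisfies it, and likewise in the past. Hence a regular language of
-- words marked at i and j is a finite disjunction of conditions past ∧ [i, j) ∧ future.

open import Defs
open import Axiom.ExcludedMiddle using (ExcludedMiddle)
open import Data.Bool.Base using (Bool; true; false; if_then_else_)
open import Data.Empty using (⊥; ⊥-elim)
open import Data.Fin.Base as Fin using (Fin; zero; suc; toℕ; fromℕ<; inject₁; fromℕ; combine; funToFin; finToFun)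
open import Data.Fin.Properties using (pigeonhole; toℕ-injective; toℕ-fromℕ<; toℕ<n; combine-injective; finToFun-funToFin)
open import Data.Integer.Base as ℤ using (ℤ; +_; -[1+_]; _≤_; _<_; _+_; _-_; -_; 0ℤ; 1ℤ)
  renaming (suc to sucℤ)
open import Data.Integer.Properties as ℤ
  using (≤-refl; ≤-reflexive; ≤-trans; <-trans; <-≤-trans; ≤-<-trans; <⇒≤; <-irrefl; ≤-antisym;
         <⇒≱; ≰⇒>; ≮⇒≥; <-cmp; _<?_)
open import Data.List.Base using (List; []; _∷_; _++_; map; zip)
open import Data.List.Membership.Propositional using (_∈_)
open import Data.List.Membership.Propositional.Properties using (∈-++⁺ˡ; ∈-++⁺ʳ)
open import Data.List.Relation.Unary.Any using (here; there)
open import Data.Nat.Base as ℕ using (ℕ; zero; suc; _^_)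
import Data.Nat.Properties as ℕ
open import Data.Product.Base using (_×_; _,_; proj₁; proj₂; ∃-syntax; Σ-syntax)
open import Data.Sum.Base using (map₂; _⊎_; inj₁; inj₂)
open import Data.Unit.Base using (⊤; tt)
open import Function.Base using (_∘_; id; case_of_)
open import Function.Bundles using (_⇔_; mk⇔; Equivalence)
open import Level using (0ℓ)
open import Relation.Binary.Definitions using (tri<; tri≈; tri>)
open import Relation.Binary.PropositionalEquality
  using (_≡_; _≢_; refl; sym; trans; cong; cong₂; subst; subst₂)
open import Relation.Nullary using (¬_; yes; no; does)

open Equivalence using (to; from)

-- Successors and induction on the integers.

infix 8 _⁺

_⁺ : ℤ → ℤ
i ⁺ = i + 1ℤ

⁺≡suc : ∀ i → i ⁺ ≡ sucℤ i
⁺≡suc i = ℤ.+-comm i 1ℤ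

i<i⁺ : ∀ {i} → i < i ⁺
i<i⁺ {i} = subst (i <_) (sym (⁺≡suc i)) (ℤ.suc[i]≤j⇒i<j ≤-refl)

i≤i⁺ : ∀ {i} → i ≤ i ⁺
i≤i⁺ = <⇒≤ i<i⁺

<⇒⁺≤ : ∀ {i j} → i < j → i ⁺ ≤ j
<⇒⁺≤ {i} {j} p = subst (_≤ j) (sym (⁺≡suc i)) (ℤ.i<j⇒suc[i]≤j p)

⁺≤⇒< : ∀ {i j} → i ⁺ ≤ j → i < j
⁺≤⇒< = <-≤-trans i<i⁺

<⁺⇒≤ : ∀ {i j} → i < j ⁺ → i ≤ j
<⁺⇒≤ p = ≮⇒≥ λ j<i → <⇒≱ p (<⇒⁺≤ j<i)

≤-gap : ∀ {i j} → i ≤ j → ∃[ n ] j ≡ i + + n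
≤-gap {i} {j} i≤j = ℤ.∣ j - i ∣ , sym (begin
  i + + ℤ.∣ j - i ∣  ≡⟨ cong (λ d → i + d) (ℤ.0≤i⇒+∣i∣≡i (ℤ.i≤j⇒0≤j-i i≤j)) ⟩
  i + (j - i)        ≡⟨ ℤ.+-comm i (j - i) ⟩
  j - i + i          ≡⟨ ℤ.+-assoc j (- i) i ⟩
  j + (- i + i)      ≡⟨ cong (λ d → j + d) (ℤ.+-inverseˡ i) ⟩
  j + 0ℤ             ≡⟨ ℤ.+-identityʳ j ⟩
  j                  ∎)
  where open Relation.Binary.PropositionalEquality.≡-Reasoning

i≤i+n : ∀ {i} n → i ≤ i + + n
i≤i+n {i} n = ℤ.i≤i+j i (+ n)

+-suc-⁺ : ∀ i n → i + + suc n ≡ (i + + n) ⁺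
+-suc-⁺ i n = trans (cong (λ m → i + + m) (ℕ.+-comm 1 n)) (sym (ℤ.+-assoc i (+ n) 1ℤ))

≤-ind : ∀ {i} (P : ℤ → Set) → P i → (∀ {j} → i ≤ j → P j → P (j ⁺)) →
        ∀ {j} → i ≤ j → P j
≤-ind {i} P base step i≤j with ≤-gap i≤j
... | n , refl = go n
  where
  go : ∀ n → P (i + + n)
  go zero    = subst P (sym (ℤ.+-identityʳ i)) base
  go (suc n) = subst P (sym (+-suc-⁺ i n)) (step (i≤i+n n) (go n))

-- Words, colourings, cuttings and regular languages.

Word : Set → Set
Word E = ℤ → E

Additive : ∀ {E n} → (Word E → ℤ → ℤ → Fin n) → Set
Additive c = ∀ {x y a b d a′ b′ d′} → a ≤ b → b ≤ d → a′ ≤ b′ → b′ ≤ d′ →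
  c x a b ≡ c y a′ b′ → c x b d ≡ c y b′ d′ → c x a d ≡ c y a′ d′

-- A finite-index congruence on finite words; col w i j is the class of the
-- factor w i, …, w (j - 1).
record Colouring (E : Set) (n : ℕ) : Set where
  field
    col        : Word E → ℤ → ℤ → Fin n
    col-empty  : ∀ {w v} i j → col w i i ≡ col v j j
    col-letter : ∀ {w v i j} → w i ≡ v j → col w i (i ⁺) ≡ col v j (j ⁺)
    col-add    : Additive col

  -- `col` takes a whole word, so independence of the letters outside the interval has to be
  -- derived: the interval is built up letter by letter from an empty one.
  col-local : ∀ {w v i j} → i ≤ j → (∀ k → i ≤ k → k < j → w k ≡ v k) →
              col w i j ≡ col v i j
  col-local {w} {v} {i} i≤j = ≤-ind (λ j → (∀ k → i ≤ k → k < j → w k ≡ v k) → col w i j ≡ col v i j)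
    (λ _ → col-empty i i)
    (λ {j} i≤j ih eq → col-add i≤j i≤i⁺ i≤j i≤i⁺
      (ih (λ k i≤k k<j → eq k i≤k (<-trans k<j i<i⁺)))
      (col-letter (eq j i≤j i<i⁺)))
    i≤j

open Colouring

-- Blocks may be empty, as the block between two marks at i = j is. `covers` makes the cuts
-- unbounded in both directions.
record Cuts (k : ℤ → ℤ) : Set where
  field
    mono   : ∀ n → k n ≤ k (sucℤ n)
    covers : ∀ x → ∃[ n ] k n ≤ x × x < k (sucℤ n)

  index : ℤ → ℤ
  index = proj₁ ∘ covers

  ≤-mono : ∀ {m n} → m ≤ n → k m ≤ k n
  ≤-mono {m} = ≤-ind (λ n → k m ≤ k n) ≤-refl
    λ {n} _ p → ≤-trans p (subst (k n ≤_) (cong k (sym (⁺≡suc n))) (mono n))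

  <-mono : ∀ {m n} → m < n → k (sucℤ m) ≤ k n
  <-mono m<n = ≤-mono (ℤ.i<j⇒suc[i]≤j m<n)

  -- Needed to evaluate a word glued from one piece per block: at a position of block `n` it reads
  -- piece `n`.
  index-unique : ∀ {n x} → k n ≤ x → x < k (sucℤ n) → index x ≡ n
  index-unique {n} {x} p q with covers x
  ... | m , p′ , q′ with <-cmp m n
  ...   | tri< m<n _ _ = ⊥-elim (<⇒≱ q′ (≤-trans (<-mono m<n) p))
  ...   | tri≈ _ m≡n _ = m≡n
  ...   | tri> _ _ n<m = ⊥-elim (<⇒≱ q (≤-trans (<-mono n<m) p′))

open Cuts

record _≈[_]_ {E n} (w : Word E) (C : Colouring E n) (v : Word E) : Set where
  constructor match
  field
    {k l} : ℤ → ℤ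
    cutsˡ : Cuts k
    cutsʳ : Cuts l
    same  : ∀ n → col C w (k n) (k (sucℤ n)) ≡ col C v (l n) (l (sucℤ n))

≈-sym : ∀ {E n} {C : Colouring E n} {w v} → w ≈[ C ] v → v ≈[ C ] w
≈-sym (match K L same) = match L K (sym ∘ same)

-- One implication suffices because matching is symmetric; the same symmetry makes complements
-- regular.
record Regular {E : Set} (L : Word E → Set) : Set where
  field
    {size}    : ℕ
    colouring : Colouring E size
    resp      : ∀ {w v} → w ≈[ colouring ] v → L w → L v

open Regular

-- Boolean closure of regular languages.

_×ᶜ_ : ∀ {E m n} → Colouring E m → Colouring E n → Colouring E (m ℕ.* n)
C ×ᶜ D = record
  { col        = λ w i j → combine (col C w i j) (col D w i j)
  ; col-empty  = λ i j → cong₂ combine (col-empty C i j) (col-empty D i j)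
  ; col-letter = λ e → cong₂ combine (col-letter C e) (col-letter D e)
  ; col-add    = λ p q p′ q′ e f →
      let (e₁ , e₂) = combine-injective _ _ _ _ e
          (f₁ , f₂) = combine-injective _ _ _ _ f
      in cong₂ combine (col-add C p q p′ q′ e₁ f₁) (col-add D p q p′ q′ e₂ f₂)
  }

regular-⇔ : ∀ {E} {L L′ : Word E → Set} → (∀ w → L w ⇔ L′ w) → Regular L → Regular L′
regular-⇔ eq R = record
  { colouring = colouring R
  ; resp      = λ {w} {v} w≈v → to (eq v) ∘ resp R w≈v ∘ from (eq w)
  }

regular-¬ : ∀ {E} {L : Word E → Set} → Regular L → Regular (λ w → ¬ L w)
regular-¬ R = record
  { colouring = colouring R
  ; resp      = λ w≈v ¬l l → ¬l (resp R (≈-sym w≈v) l)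
  }

regular-× : ∀ {E} {L M : Word E → Set} → Regular L → Regular M → Regular (λ w → L w × M w)
regular-× R S = record
  { colouring = colouring R ×ᶜ colouring S
  ; resp      = λ (match K L same) (l , m) →
      resp R (match K L (proj₁ ∘ split ∘ same)) l ,
      resp S (match K L (proj₂ ∘ split ∘ same)) m
  }
  where
  split : ∀ {a b c d} → combine {size R} {size S} a b ≡ combine c d → a ≡ c × b ≡ d
  split = combine-injective _ _ _ _

funToFin-cong : ∀ {m n} {f g : Fin m → Fin n} → (∀ a → f a ≡ g a) → funToFin f ≡ funToFin g
funToFin-cong {zero}  eq = refl
funToFin-cong {suc m} eq = cong₂ combine (eq zero) (funToFin-cong (eq ∘ suc))


-- Finite families of propositions as colours.

module Classical (em : ExcludedMiddle 0ℓ) where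

  ⟦_⟧ : Set → Bool
  ⟦ P ⟧ = does (em {P})

  ⟦⟧-true : ∀ {P} → ⟦ P ⟧ ≡ true ⇔ P
  ⟦⟧-true {P} with em {P}
  ... | yes p = mk⇔ (λ _ → p) (λ _ → refl)
  ... | no ¬p = mk⇔ (λ ()) (λ p → ⊥-elim (¬p p))

  ⟦⟧-cong : ∀ {P Q} → P ⇔ Q → ⟦ P ⟧ ≡ ⟦ Q ⟧
  ⟦⟧-cong {P} {Q} eq with em {P} | em {Q}
  ... | yes p | yes q = refl
  ... | yes p | no ¬q = ⊥-elim (¬q (to eq p))
  ... | no ¬p | yes q = ⊥-elim (¬p (from eq q))
  ... | no ¬p | no ¬q = refl

  ⟦⟧-cases : ∀ {P} (S : Bool → Set) → (P × S true ⊎ ¬ P × S false) ⇔ S ⟦ P ⟧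
  ⟦⟧-cases {P} S with em {P}
  ... | yes p = mk⇔ (λ { (inj₁ (_ , s)) → s ; (inj₂ (¬p , _)) → ⊥-elim (¬p p) }) (λ s → inj₁ (p , s))
  ... | no ¬p = mk⇔ (λ { (inj₁ (p , _)) → ⊥-elim (¬p p) ; (inj₂ (_ , s)) → s }) (λ s → inj₂ (¬p , s))

  dne : ∀ {P : Set} → ¬ ¬ P → P
  dne {P} ¬¬p with em {P}
  ... | yes p = p
  ... | no ¬p = ⊥-elim (¬¬p ¬p)

  bit : Bool → Fin 2
  bit b = if b then suc zero else zero

  bit-injective : ∀ {a b} → bit a ≡ bit b → a ≡ b
  bit-injective {false} {false} _ = refl
  bit-injective {true}  {true}  _ = refl

  -- The vector of truth values as a number: two families have the same code exactly when they are
  -- pointwise equivalent.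
  code : ∀ {m} → (Fin m → Set) → Fin (2 ^ m)
  code Q = funToFin (λ a → bit ⟦ Q a ⟧)

  code-cong : ∀ {m} {Q R : Fin m → Set} → (∀ a → Q a ⇔ R a) → code Q ≡ code R
  code-cong eq = funToFin-cong (λ a → cong bit (⟦⟧-cong (eq a)))

  code-injective : ∀ {m} {Q R : Fin m → Set} → code Q ≡ code R → ∀ a → Q a → R a
  code-injective {Q = Q} {R} eq a q = to ⟦⟧-true (trans (sym same) (from ⟦⟧-true q))
    where
    same : ⟦ Q a ⟧ ≡ ⟦ R a ⟧
    same = bit-injective (trans (sym (finToFun-funToFin (λ a → bit ⟦ Q a ⟧) a))
      (trans (cong (λ c → finToFun c a) eq) (finToFun-funToFin (λ a → bit ⟦ R a ⟧) a)))

  module _ {E m} (Q : Fin m → Word E → ℤ → ℤ → Set) where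

    codes : Word E → ℤ → ℤ → Fin (2 ^ m)
    codes w i j = code (λ a → Q a w i j)

    codes-injective : ∀ {w v i j i′ j′} → codes w i j ≡ codes v i′ j′ → ∀ a → Q a w i j → Q a v i′ j′
    codes-injective = code-injective

    -- An interval is coloured by the set of predicates that hold on it. Implications are enough as
    -- hypotheses, since equal codes can be used in both directions.
    codeColouring :
      (∀ a {w v} i j → Q a w i i → Q a v j j) →
      (∀ a {w v i j} → w i ≡ v j → Q a w i (i ⁺) → Q a v j (j ⁺)) →
      (∀ a {w v i j k i′ j′ k′} → i ≤ j → j ≤ k → i′ ≤ j′ → j′ ≤ k′ →
        (∀ b → Q b w i j → Q b v i′ j′) → (∀ b → Q b w j k → Q b v j′ k′) →
        Q a w i k → Q a v i′ k′) →
      Colouring E (2 ^ m)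
    codeColouring empty letter chop = record
      { col        = codes
      ; col-empty  = λ i j → code-cong λ a → mk⇔ (empty a i j) (empty a j i)
      ; col-letter = λ e → code-cong λ a → mk⇔ (letter a e) (letter a (sym e))
      ; col-add    = λ p q p′ q′ e f → code-cong λ a → mk⇔
          (chop a p q p′ q′ (code-injective e) (code-injective f))
          (chop a p′ q′ p q (code-injective (sym e)) (code-injective (sym f)))
      }

  -- Projection of regular languages.

  infixl 5 _▹_

  _▹_ : ∀ {E} → Word E → Word Bool → Word (E × Bool)
  (w ▹ b) k = w k , b k

  Labelled : ∀ {E n} → Colouring (E × Bool) n → Fin n → Word E → ℤ → ℤ → Set
  Labelled C c w i j = ∃[ b ] col C (w ▹ b) i j ≡ c

  -- The subset construction: a factor is coloured by the set of colours that its labellings can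
  -- attain.
  projectColouring : ∀ {E n} → Colouring (E × Bool) n → Colouring E (2 ^ n)
  projectColouring {E} {n} C = codeColouring Q
    (λ c i j (b , e) → b , trans (col-empty C j i) e)
    (λ c {w} {v} {i} {j} w≡v (b , e) → (λ _ → b i) ,
      trans (col-letter C {v ▹ (λ _ → b i)} {w ▹ b} (cong (_, b i) (sym w≡v))) e)
    chop
    where
    Q = Labelled C

    chop : ∀ a {w v i j k i′ j′ k′} → i ≤ j → j ≤ k → i′ ≤ j′ → j′ ≤ k′ →
      (∀ b → Q b w i j → Q b v i′ j′) → (∀ b → Q b w j k → Q b v j′ k′) →
      Q a w i k → Q a v i′ k′
    -- Both halves of the labelling `b` have counterparts of the same colour on `v`; these are glued
    -- at `j′`.
    chop _ {v = v} {j′ = j′} i≤j j≤k i′≤j′ j′≤k′ f g (b , refl)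
      with f _ (b , refl) | g _ (b , refl)
    ... | b₁ , e₁ | b₂ , e₂ = b′ , col-add C i′≤j′ j′≤k′ i≤j j≤k
      (trans (col-local C i′≤j′ λ x _ x<j′ → cong (v x ,_) (left x<j′)) e₁)
      (trans (col-local C j′≤k′ λ x j′≤x _ → cong (v x ,_) (right j′≤x)) e₂)
      where
      b′ : Word Bool
      b′ x = if does (x <? j′) then b₁ x else b₂ x

      left : ∀ {x} → x < j′ → b′ x ≡ b₁ x
      left {x} x<j′ with x <? j′
      ... | yes _ = refl
      ... | no ≮  = ⊥-elim (≮ x<j′)

      right : ∀ {x} → j′ ≤ x → b′ x ≡ b₂ x
      right {x} j′≤x with x <? j′
      ... | yes p = ⊥-elim (<⇒≱ p j′≤x)
      ... | no _  = refl

  -- Matching blocks admit labellings of the same colours, so the labelling of `w` is imitated on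
  -- `v` block by block and the pieces are glued along the cuts.
  regular-∃ : ∀ {E} {L : Word (E × Bool) → Set} → Regular L → Regular (λ w → ∃[ b ] L (w ▹ b))
  regular-∃ {E} {L} R = record { colouring = projectColouring C ; resp = λ p (b , l) → glue p b l }
    where
    C = colouring R

    glue : ∀ {w v} → w ≈[ projectColouring C ] v → ∀ b → L (w ▹ b) → ∃[ b′ ] L (v ▹ b′)
    glue {w} {v} (match {k} {l} K K′ same) b Lw = b′ , resp R (match K K′ same′) Lw
      where
      piece : ∀ n → ∃[ b′ ] col C (v ▹ b′) (l n) (l (sucℤ n)) ≡ col C (w ▹ b) (k n) (k (sucℤ n))
      piece n = codes-injective (Labelled C) (same n) _ (b , refl)

      b′ : Word Bool
      b′ x = proj₁ (piece (index K′ x)) x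

      same′ : ∀ n → col C (w ▹ b) (k n) (k (sucℤ n)) ≡ col C (v ▹ b′) (l n) (l (sucℤ n))
      same′ n = trans (sym (proj₂ (piece n))) (col-local C (mono K′ n) λ x p q →
        cong (λ m → v x , proj₁ (piece m) x) (sym (index-unique K′ p q)))

  -- Occurrence and order of letters.

  module _ {E : Set} (S T : E → Set) where

    private
      -- The first two predicates make the third compositional: a cut may fall between `x` and `y`,
      -- leaving an `S` on its left and a `T` on its right.
      Q : Fin 3 → Word E → ℤ → ℤ → Set
      Q zero             w i j = ∃[ x ] (i ≤ x × x < j) × S (w x)
      Q (suc zero)       w i j = ∃[ x ] (i ≤ x × x < j) × T (w x)
      Q (suc (suc zero)) w i j =
        ∃[ x ] ∃[ y ] (i ≤ x × x < y × y < j) × S (w x) × T (w y)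

      sole : ∀ {i x} → i ≤ x → x < i ⁺ → x ≡ i
      sole p q = ≤-antisym (<⁺⇒≤ q) p

      C : Colouring E 8
      C = codeColouring Q empty letter chop
        where
        empty : ∀ a {w v} i j → Q a w i i → Q a v j j
        empty zero _ _ (x , (p , q) , _) = ⊥-elim (<⇒≱ q p)
        empty (suc zero) _ _ (x , (p , q) , _) = ⊥-elim (<⇒≱ q p)
        empty (suc (suc zero)) _ _ (x , y , (p , q , r) , _) =
          ⊥-elim (<⇒≱ (<-trans q r) p)

        letter : ∀ a {w v i j} → w i ≡ v j → Q a w i (i ⁺) → Q a v j (j ⁺)
        letter zero {w} e (x , (p , q) , s) =
          _ , (≤-refl , i<i⁺) , subst S (trans (cong w (sole p q)) e) s
        letter (suc zero) {w} e (x , (p , q) , s) =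
          _ , (≤-refl , i<i⁺) , subst T (trans (cong w (sole p q)) e) s
        letter (suc (suc zero)) e (x , y , (p , q , r) , s , t) =
          ⊥-elim (<⇒≱ q (≤-trans (<⁺⇒≤ r) p))

        chop : ∀ a {w v i j k i′ j′ k′} → i ≤ j → j ≤ k → i′ ≤ j′ → j′ ≤ k′ →
          (∀ b → Q b w i j → Q b v i′ j′) → (∀ b → Q b w j k → Q b v j′ k′) →
          Q a w i k → Q a v i′ k′
        chop zero {j = j} _ _ i′≤j′ j′≤k′ f g (x , (p , q) , s) with x <? j
        ... | yes x<j = let (x′ , (p′ , q′) , s′) = f zero (x , (p , x<j) , s)
                        in x′ , (p′ , <-≤-trans q′ j′≤k′) , s′
        ... | no x≮j  = let (x′ , (p′ , q′) , s′) = g zero (x , (≮⇒≥ x≮j , q) , s)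
                        in x′ , (≤-trans i′≤j′ p′ , q′) , s′
        chop (suc zero) {j = j} _ _ i′≤j′ j′≤k′ f g (x , (p , q) , s) with x <? j
        ... | yes x<j = let (x′ , (p′ , q′) , s′) = f (suc zero) (x , (p , x<j) , s)
                        in x′ , (p′ , <-≤-trans q′ j′≤k′) , s′
        ... | no x≮j  = let (x′ , (p′ , q′) , s′) = g (suc zero) (x , (≮⇒≥ x≮j , q) , s)
                        in x′ , (≤-trans i′≤j′ p′ , q′) , s′
        chop (suc (suc zero)) {j = j} _ _ i′≤j′ j′≤k′ f g (x , y , (p , q , r) , s , t)
          with x <? j | y <? j
        ... | yes x<j | yes y<j =
          let (x′ , y′ , (p′ , q′ , r′) , st) = f (suc (suc zero)) (x , y , (p , q , y<j) , s , t)
          in x′ , y′ , (p′ , q′ , <-≤-trans r′ j′≤k′) , st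
        ... | yes x<j | no y≮j =
          let (x′ , (p₁ , q₁) , s′) = f zero (x , (p , x<j) , s)
              (y′ , (p₂ , q₂) , t′) = g (suc zero) (y , (≮⇒≥ y≮j , r) , t)
          in x′ , y′ , (p₁ , <-≤-trans q₁ p₂ , q₂) , s′ , t′
        ... | no x≮j | yes y<j = ⊥-elim (x≮j (<-trans q y<j))
        ... | no x≮j | no y≮j =
          let (x′ , y′ , (p′ , q′ , r′) , st) = g (suc (suc zero)) (x , y , (≮⇒≥ x≮j , q , r) , s , t)
          in x′ , y′ , (≤-trans i′≤j′ p′ , q′ , r′) , st

    -- Positions in one block are transferred together by the third predicate. Positions in
    -- different blocks are transferred separately, and the order of the blocks keeps them in order.
    regular-< : Regular (λ w → ∃[ x ] ∃[ y ] x < y × S (w x) × T (w y))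
    regular-< = record { colouring = C ; resp = transfer }
      where
      transfer : ∀ {w v} → w ≈[ C ] v → ∃[ x ] ∃[ y ] x < y × S (w x) × T (w y) →
                 ∃[ x ] ∃[ y ] x < y × S (v x) × T (v y)
      transfer (match K L same) (x , y , x<y , s , t) with covers K x | covers K y
      ... | m , p , q | n , p′ , q′ with <-cmp m n
      ...   | tri< m<n _ _ =
        let (x′ , (p₁ , q₁) , s′) = codes-injective Q (same m) zero (x , (p , q) , s)
            (y′ , (p₂ , q₂) , t′) = codes-injective Q (same n) (suc zero) (y , (p′ , q′) , t)
        in x′ , y′ , <-≤-trans q₁ (≤-trans (<-mono L m<n) p₂) , s′ , t′
      ...   | tri≈ _ refl _ =
        let (x′ , y′ , (_ , r , _) , st) = codes-injective Q (same m) (suc (suc zero)) (x , y , (p , x<y , q′) , s , t)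
        in x′ , y′ , r , st
      ...   | tri> _ _ n<m = ⊥-elim (<⇒≱ x<y (<⇒≤ (<-≤-trans q′ (≤-trans (<-mono K n<m) p))))

  -- With a trivial second condition `regular-<` asks for `S` only, since every position has a
  -- successor.
  regular-some : ∀ {E} (S : E → Set) → Regular (λ w → ∃[ x ] S (w x))
  regular-some S = regular-⇔ (λ w → mk⇔ (forth {w}) (λ (x , s) → x , x ⁺ , i<i⁺ , s , tt))
    (regular-< S (λ _ → ⊤))
    where
    forth : ∀ {w} → ∃[ x ] ∃[ y ] x < y × S (w x) × ⊤ → ∃[ x ] S (w x)
    forth (x , _ , _ , s , _) = x , s

  -- Marked positions.

  -- A position i is encoded by the set of positions k ≥ i.
  Marks : ∀ {E} → (E → Bool) → Word E → ℤ → Set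
  Marks X w i = ∀ k → X (w k) ≡ true ⇔ i ≤ k

  mark : ℤ → Word Bool
  mark i k = ⟦ i ≤ k ⟧

  marks-mark : ∀ i → Marks id (mark i) i
  marks-mark i k = ⟦⟧-true

  marks-unique : ∀ {E} (X : E → Bool) {w i j} → Marks X w i → Marks X w j → i ≡ j
  marks-unique X m n = ≤-antisym (to (m _) (from (n _) ≤-refl)) (to (n _) (from (m _) ≤-refl))

  module _ {E : Set} (X : E → Bool) where

    Cut : Word E → Set
    Cut w = ∃[ i ] Marks X w i

    -- A set of integers has the form of all k ≥ i iff it is upward closed, nonempty and not
    -- everything; each of the three conditions is regular.
    regular-cut : Regular Cut
    regular-cut = regular-⇔ (λ w → mk⇔ (forth w) (back w))
      (regular-× (regular-¬ (regular-< (λ e → X e ≡ true) (λ e → X e ≢ true)))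
        (regular-× (regular-some (λ e → X e ≡ true)) (regular-some (λ e → X e ≢ true))))
      where
      forth : ∀ w → ¬ (∃[ x ] ∃[ y ] x < y × X (w x) ≡ true × X (w y) ≢ true) ×
        (∃[ x ] X (w x) ≡ true) × (∃[ x ] X (w x) ≢ true) → Cut w
      forth w (up , (x , Xx) , (y , ¬Xy)) = k ⁺ , λ l → mk⇔
        (λ Xl → <⇒⁺≤ (case <-cmp k l of λ where
          (tri< k<l _ _)  → k<l
          (tri≈ _ refl _) → ⊥-elim (¬Xk Xl)
          (tri> _ _ l<k)  → ⊥-elim (up (l , k , l<k , Xl , ¬Xk))))
        (λ k⁺≤l → case <-cmp (k ⁺) l of λ where
          (tri< k⁺<l _ _) → dne λ ¬Xl → up (k ⁺ , l , k⁺<l , Xk⁺ , ¬Xl)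
          (tri≈ _ refl _) → Xk⁺
          (tri> _ _ l<k⁺) → ⊥-elim (<⇒≱ l<k⁺ k⁺≤l))
        where
        -- Going up from `y`, which is outside the set, to a member, some step enters the set; the
        -- position entered is its least element.
        jump : ∀ {j} → y ≤ j → X (w j) ≡ true → ∃[ k ] X (w k) ≢ true × X (w (k ⁺)) ≡ true
        jump = ≤-ind (λ j → X (w j) ≡ true → ∃[ k ] X (w k) ≢ true × X (w (k ⁺)) ≡ true)
          (λ Xy → ⊥-elim (¬Xy Xy))
          (λ {j} _ ih Xj⁺ → case em {X (w j) ≡ true} of λ where
            (yes Xj) → ih Xj
            (no ¬Xj) → j , ¬Xj , Xj⁺)

        found = jump (≮⇒≥ λ x<y → up (x , y , x<y , Xx , ¬Xy)) Xx
        k   = proj₁ found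
        ¬Xk = proj₁ (proj₂ found)
        Xk⁺ = proj₂ (proj₂ found)

      back : ∀ w → Cut w → ¬ (∃[ x ] ∃[ y ] x < y × X (w x) ≡ true × X (w y) ≢ true) ×
        (∃[ x ] X (w x) ≡ true) × (∃[ x ] X (w x) ≢ true)
      back w (i , m) =
        (λ (x , y , x<y , Xx , ¬Xy) → ¬Xy (from (m y) (≤-trans (to (m x) Xx) (<⇒≤ x<y)))) ,
        (i , from (m i) ≤-refl) ,
        (ℤ.pred i , λ Xi → <⇒≱ (ℤ.i≤pred[j]⇒i<j ≤-refl) (to (m _) Xi))

  module _ {E : Set} (X Y : E → Bool) where

    Next : Word E → Set
    Next w = ∃[ i ] Marks X w i × Marks Y w (i ⁺)

    -- With marks at i and j, the positions in `X` but not in `Y` are those of [i, j), and there is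
    -- exactly one of them iff j is the successor of i.
    regular-next : Regular Next
    regular-next = regular-⇔ (λ w → mk⇔ forth back)
      (regular-× (regular-cut X) (regular-× (regular-cut Y)
        (regular-× (regular-some D) (regular-¬ (regular-< D D)))))
      where
      D : E → Set
      D e = X e ≡ true × Y e ≢ true

      forth : ∀ {w} → Cut X w × Cut Y w × (∃[ x ] D (w x)) ×
        ¬ (∃[ x ] ∃[ y ] x < y × D (w x) × D (w y)) → Next w
      forth {w} ((i , m) , (j , n) , (x , Xx , ¬Yx) , unique) = i , m , subst (Marks Y w) j≡i⁺ n
        where
        i<j : i < j
        i<j = ≤-<-trans (to (m x) Xx) (≰⇒> λ j≤x → ¬Yx (from (n x) j≤x))

        j≡i⁺ : j ≡ i ⁺
        j≡i⁺ = ≤-antisym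
          (≮⇒≥ λ i⁺<j → unique (i , i ⁺ , i<i⁺ ,
            (from (m i) ≤-refl , λ Yi → <⇒≱ i<j (to (n i) Yi)) ,
            (from (m (i ⁺)) i≤i⁺ , λ Yi → <⇒≱ i⁺<j (to (n (i ⁺)) Yi))))
          (<⇒⁺≤ i<j)

      back : ∀ {w} → Next w → Cut X w × Cut Y w × (∃[ x ] D (w x)) ×
        ¬ (∃[ x ] ∃[ y ] x < y × D (w x) × D (w y))
      back (i , m , n) = (i , m) , (i ⁺ , n) ,
        (i , from (m i) ≤-refl , λ Yi → <⇒≱ i<i⁺ (to (n i) Yi)) ,
        λ (x , y , x<y , (Xx , _) , (_ , ¬Yy)) →
          <⇒≱ (≤-<-trans (to (m x) Xx) x<y) (<⁺⇒≤ (≰⇒> (¬Yy ∘ from (n y))))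

  module _ {E : Set} (X : E → Bool) (S : E → Set) where

    At : Word E → Set
    At w = ∃[ i ] Marks X w i × S (w i)

    -- A quantified track marking `i ⁺` isolates i as the only position in `X` and outside that
    -- track.
    regular-at : Regular At
    regular-at = regular-⇔
      (λ w → mk⇔ forth
        (λ (i , m , s) → mark (i ⁺) , (i , m , marks-mark (i ⁺)) ,
          i , from (m i) ≤-refl , (λ b → <⇒≱ i<i⁺ (to ⟦⟧-true b)) , s))
      (regular-∃ (regular-× (regular-next (X ∘ proj₁) proj₂)
        (regular-some λ (e , b) → X e ≡ true × b ≢ true × S e)))
      where
      forth : ∀ {w} → ∃[ b ] Next (X ∘ proj₁) proj₂ (w ▹ b) ×
        (∃[ x ] X (w x) ≡ true × b x ≢ true × S (w x)) → At w
      forth {w} (b , (i , m , n) , (x , Xx , ¬bx , s)) = i , m , subst (S ∘ w)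
        (≤-antisym (<⁺⇒≤ (≰⇒> (¬bx ∘ from (n x)))) (to (m x) Xx)) s

  module _ {E : Set} (X Y : E → Bool) where

    Span : (ℤ → ℤ → Set) → Word E → Set
    Span P w = ∃[ i ] ∃[ j ] i ≤ j × Marks X w i × Marks Y w j × P i j

    Ordered : Word E → Set
    Ordered = Span (λ _ _ → ⊤)

    -- For marks at i and j, i ≤ j says that the letter at j belongs to `X`.
    regular-ordered : Regular Ordered
    regular-ordered = regular-⇔
      (λ w → mk⇔ forth (λ (i , j , i≤j , m , n , _) → (i , m) , (j , n , from (m j) i≤j)))
      (regular-× (regular-cut X) (regular-at Y (λ e → X e ≡ true)))
      where
      forth : ∀ {w} → Cut X w × At Y (λ e → X e ≡ true) w → Ordered w
      forth ((i , m) , (j , n , Xj)) = i , j , to (m j) Xj , m , n , tt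

  -- Iteration as chains.

  data Star (P : ℤ → ℤ → Set) : ℤ → ℤ → Set where
    nil  : ∀ {i} → Star P i i
    cons : ∀ {i k j} → i < k → P i k → Star P k j → Star P i j

  star-++ : ∀ {P i k j} → Star P i k → Star P k j → Star P i j
  star-++ nil           t = t
  star-++ (cons lt p s) t = cons lt p (star-++ s t)

  star-step : ∀ {P i j} → i ≤ j → P i j → Star P i j
  star-step {i = i} {j} i≤j p with <-cmp i j
  ... | tri< i<j _ _  = cons i<j p nil
  ... | tri≈ _ refl _ = nil
  ... | tri> _ _ j<i  = ⊥-elim (<⇒≱ j<i i≤j)

  -- The second alternative in the semantics of `_✶`, with a relation in place of the formula.
  Chain : (ℤ → ℤ → Set) → ℤ → ℤ → Set
  Chain P i j = ∃[ N ] Σ[ k ∈ (Fin (suc N) → ℤ) ]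
    k zero ≡ i × k (fromℕ N) ≡ j ×
    ((n : Fin N) → k (inject₁ n) < k (suc n) × P (k (inject₁ n)) (k (suc n)))

  chain⇒star : ∀ {P i j} → Chain P i j → Star P i j
  chain⇒star {P} (N , k , refl , refl , s) = go N k s
    where
    go : ∀ N (k : Fin (suc N) → ℤ) →
      ((n : Fin N) → k (inject₁ n) < k (suc n) × P (k (inject₁ n)) (k (suc n))) →
      Star P (k zero) (k (fromℕ N))
    go zero    k s = nil
    go (suc N) k s = cons (proj₁ (s zero)) (proj₂ (s zero)) (go N (k ∘ suc) (s ∘ suc))

  star⇒chain : ∀ {P i j} → Star P i j → Chain P i j
  star⇒chain {i = i} nil = 0 , (λ _ → i) , refl , refl , λ ()
  star⇒chain {P} {i} (cons lt p s) with star⇒chain s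
  ... | N , k , refl , refl , t = suc N , k′ , refl , refl , t′
    where
    k′ : Fin (suc (suc N)) → ℤ
    k′ zero    = i
    k′ (suc n) = k n

    t′ : (n : Fin (suc N)) → k′ (inject₁ n) < k′ (suc n) × P (k′ (inject₁ n)) (k′ (suc n))
    t′ zero    = lt , p
    t′ (suc n) = t n

  -- Regularity of satisfaction.

  module _ {V : Set} where

    ⊨✶ : ∀ (σ : Model V) A {i j} → σ ⟨ i ⋯ j ⟩⊨ A ✶ ⇔ Star (λ i j → σ ⟨ i ⋯ j ⟩⊨ A) i j
    ⊨✶ σ A = mk⇔ (λ { (inj₁ refl) → nil ; (inj₂ c) → chain⇒star c }) (inj₂ ∘ star⇒chain)

    Holds : ∀ {E} (val : E → V → Set) (X Y : E → Bool) → Formula V → Word E → Set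
    Holds val X Y A w = Span X Y (λ i j → (val ∘ w) ⟨ i ⋯ j ⟩⊨ A) w

    -- Induction on `A`. Subformulas are evaluated on other intervals, whose new end points become
    -- quantified tracks; therefore alphabet, valuation and marking tracks are arbitrary.
    regular-holds : ∀ A {E} (val : E → V → Set) (X Y : E → Bool) → Regular (Holds val X Y A)
    regular-holds ⊥′ val X Y = regular-⇔
      (λ w → mk⇔ (λ (_ , f) → ⊥-elim f) (λ (_ , _ , _ , _ , _ , f) → ⊥-elim f))
      (regular-some (λ _ → ⊥))
    regular-holds (var q) val X Y = regular-⇔
      (λ w → mk⇔ forth
        (λ (i , j , i≤j , m , n , s) → (i , j , i≤j , m , n , tt) , (i , m , s)))
      (regular-× (regular-ordered X Y) (regular-at X (λ e → val e q)))
      where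
      forth : ∀ {w} → Ordered X Y w × At X (λ e → val e q) w → Holds val X Y (var q) w
      forth ((i , j , i≤j , m , n , _) , (i′ , m′ , s)) =
        i′ , j , subst (_≤ j) (marks-unique X m m′) i≤j , m′ , n , s
    -- The negation also holds on badly marked words, so `Ordered` is added. Uniqueness of marks
    -- ensures that both subformulas speak of the same interval.
    regular-holds (A ⊃ B) val X Y = regular-⇔ (λ w → mk⇔ forth back)
      (regular-× (regular-ordered X Y)
        (regular-¬ (regular-× (regular-holds A val X Y) (regular-¬ (regular-holds B val X Y)))))
      where
      forth : ∀ {w} → Ordered X Y w × ¬ (Holds val X Y A w × ¬ Holds val X Y B w) → Holds val X Y (A ⊃ B) w
      forth {w} ((i , j , i≤j , m , n , _) , imp) = i , j , i≤j , m , n , (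
        case em {(val ∘ w) ⟨ i ⋯ j ⟩⊨ A} , em {(val ∘ w) ⟨ i ⋯ j ⟩⊨ B} of λ where
          (no ¬a , _)    → inj₁ ¬a
          (_ , yes b)    → inj₂ b
          (yes a , no ¬b) → ⊥-elim (imp ((i , j , i≤j , m , n , a) ,
            λ (i′ , j′ , _ , m′ , n′ , b) → ¬b (subst₂ (λ i j → (val ∘ w) ⟨ i ⋯ j ⟩⊨ B)
              (marks-unique X m′ m) (marks-unique Y n′ n) b))))

      back : ∀ {w} → Holds val X Y (A ⊃ B) w → Ordered X Y w × ¬ (Holds val X Y A w × ¬ Holds val X Y B w)
      back {w} (i , j , i≤j , m , n , imp) = (i , j , i≤j , m , n , tt) ,
        λ ((i′ , j′ , _ , m′ , n′ , a) , ¬b) → case imp of λ where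
          (inj₁ ¬a) → ¬a (subst₂ (λ i j → (val ∘ w) ⟨ i ⋯ j ⟩⊨ A)
            (marks-unique X m′ m) (marks-unique Y n′ n) a)
          (inj₂ b)  → ¬b (i , j , i≤j , m , n , b)
    regular-holds (○ A) val X Y = regular-⇔ (λ w → mk⇔ forth
        (λ (i , j , i≤j , m , n , i<j , a) → mark (i ⁺) ,
          (i , m , marks-mark (i ⁺)) , (i ⁺ , j , <⇒⁺≤ i<j , marks-mark (i ⁺) , n , a)))
      (regular-∃ (regular-× (regular-next (X ∘ proj₁) proj₂)
        (regular-holds A (val ∘ proj₁) proj₂ (Y ∘ proj₁))))
      where
      forth : ∀ {w} → ∃[ b ] Next (X ∘ proj₁) proj₂ (w ▹ b) ×
        Holds (val ∘ proj₁) proj₂ (Y ∘ proj₁) A (w ▹ b) → Holds val X Y (○ A) w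
      forth (b , (i , m , m⁺) , (i′ , j , i′≤j , m′ , n , a)) with marks-unique id m′ m⁺
      ... | refl = i , j , <⇒≤ (⁺≤⇒< i′≤j) , m , n , ⁺≤⇒< i′≤j , a
    regular-holds (A ⨟ B) val X Y = regular-⇔ (λ w → mk⇔ forth
        (λ (i , j , _ , m , n , k , (i≤k , k≤j) , a , b) → mark k ,
          (i , k , i≤k , m , marks-mark k , a) , (k , j , k≤j , marks-mark k , n , b)))
      (regular-∃ (regular-× (regular-holds A (val ∘ proj₁) (X ∘ proj₁) proj₂)
        (regular-holds B (val ∘ proj₁) proj₂ (Y ∘ proj₁))))
      where
      forth : ∀ {w} → ∃[ b ] Holds (val ∘ proj₁) (X ∘ proj₁) proj₂ A (w ▹ b) ×
        Holds (val ∘ proj₁) proj₂ (Y ∘ proj₁) B (w ▹ b) → Holds val X Y (A ⨟ B) w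
      forth (_ , (i , k , i≤k , m , l , a) , (k′ , j , k≤j , l′ , n , b)) with marks-unique id l′ l
      ... | refl = i , j , ≤-trans i≤k k≤j , m , n , k , (i≤k , k≤j) , a , b
    regular-holds (◇ₗ A) val X Y = regular-⇔ (λ w → mk⇔ forth
        (λ (i , j , i≤j , m , n , k , k≤i , a) → (i , j , i≤j , m , n , tt) ,
          mark k , (k , i , k≤i , marks-mark k , m , a)))
      (regular-× (regular-ordered X Y) (regular-∃ (regular-holds A (val ∘ proj₁) proj₂ (X ∘ proj₁))))
      where
      forth : ∀ {w} → Ordered X Y w × ∃[ b ] Holds (val ∘ proj₁) proj₂ (X ∘ proj₁) A (w ▹ b) →
        Holds val X Y (◇ₗ A) w
      forth ((i , j , i≤j , m , n , _) , _ , (k , i′ , k≤i , _ , m′ , a)) with marks-unique X m′ m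
      ... | refl = i , j , i≤j , m , n , k , k≤i , a
    regular-holds (◇ᵣ A) val X Y = regular-⇔ (λ w → mk⇔ forth
        (λ (i , j , i≤j , m , n , k , j≤k , a) → (i , j , i≤j , m , n , tt) ,
          mark k , (j , k , j≤k , n , marks-mark k , a)))
      (regular-× (regular-ordered X Y) (regular-∃ (regular-holds A (val ∘ proj₁) (Y ∘ proj₁) proj₂)))
      where
      forth : ∀ {w} → Ordered X Y w × ∃[ b ] Holds (val ∘ proj₁) (Y ∘ proj₁) proj₂ A (w ▹ b) →
        Holds val X Y (◇ᵣ A) w
      forth ((i , j , i≤j , m , n , _) , _ , (j′ , k , j≤k , n′ , _ , a)) with marks-unique Y n′ n
      ... | refl = i , j , i≤j , m , n , k , j≤k , a
    -- A ✶ links i to j iff every set of positions that contains i and is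
    -- closed under A-steps contains j.
    regular-holds (A ✶) {E} val X Y = regular-⇔ (λ w → mk⇔ forth back)
      (regular-× (regular-ordered X Y) (regular-¬ (regular-∃
        (regular-× (regular-at (X ∘ proj₁) In)
        (regular-× (regular-¬ (regular-at (Y ∘ proj₁) In))
        (regular-¬ (regular-∃ (regular-∃
          (regular-× (regular-holds A (val ∘ proj₁ ∘ proj₁ ∘ proj₁) (proj₂ ∘ proj₁) proj₂)
          (regular-× (regular-at (proj₂ ∘ proj₁) (In ∘ proj₁ ∘ proj₁))
          (regular-¬ (regular-at proj₂ (In ∘ proj₁ ∘ proj₁)))))))))))))
      where
      In : E × Bool → Set
      In (_ , z) = z ≡ true

      -- Failure of closure: an `A`-step from `a` to `b` starts inside the set and ends outside it.
      Leaves : Word (E × Bool) → Set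
      Leaves w = ∃[ a ] ∃[ b ] Holds (val ∘ proj₁ ∘ proj₁ ∘ proj₁) (proj₂ ∘ proj₁) proj₂ A (w ▹ a ▹ b) ×
        At (proj₂ ∘ proj₁) (In ∘ proj₁ ∘ proj₁) (w ▹ a ▹ b) ×
        ¬ At proj₂ (In ∘ proj₁ ∘ proj₁) (w ▹ a ▹ b)

      Separated : Word E → Set
      Separated w = ∃[ z ] At (X ∘ proj₁) In (w ▹ z) × ¬ At (Y ∘ proj₁) In (w ▹ z) × ¬ Leaves (w ▹ z)

      forth : ∀ {w} → Ordered X Y w × ¬ Separated w → Holds val X Y (A ✶) w
      -- If no chain links `i` to `j`, the set of positions reachable from `i` separates them.
      forth {w} ((i , j , i≤j , m , n , _) , ¬sep) = i , j , i≤j , m , n , from (⊨✶ (val ∘ w) A) (dne λ ¬s →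
        ¬sep (z , (i , m , from ⟦⟧-true nil) ,
          (λ (j′ , n′ , s) → ¬s (subst S (marks-unique Y n′ n) (to ⟦⟧-true s))) ,
          λ (a , b , (k , l , k≤l , o , p , h) , (k′ , o′ , s) , ¬t) →
            ¬t (l , p , from ⟦⟧-true (star-++ (subst S (marks-unique id o′ o) (to ⟦⟧-true s)) (star-step k≤l h)))))
        where
        S : ℤ → Set
        S = Star (λ i j → (val ∘ w) ⟨ i ⋯ j ⟩⊨ A) i

        z : Word Bool
        z k = ⟦ S k ⟧

      back : ∀ {w} → Holds val X Y (A ✶) w → Ordered X Y w × ¬ Separated w
      back {w} (i , j , i≤j , m , n , s) = (i , j , i≤j , m , n , tt) ,
        λ (z , (i′ , m′ , zi) , ¬zj , ¬leaves) → ¬zj (j , n ,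
          walk z ¬leaves (to (⊨✶ (val ∘ w) A) s) (subst (λ i → z i ≡ true) (marks-unique X m′ m) zi))
        where
        walk : ∀ z → ¬ Leaves (w ▹ z) → ∀ {i j} → Star (λ i j → (val ∘ w) ⟨ i ⋯ j ⟩⊨ A) i j →
               z i ≡ true → z j ≡ true
        walk z ¬l nil zi = zi
        walk z ¬l (cons {i} {k} i<k h s) zi = walk z ¬l s (dne λ ¬zk → ¬l (mark i , mark k ,
          (i , k , <⇒≤ i<k , marks-mark i , marks-mark k , h) , (i , marks-mark i , zi) ,
          λ (k′ , o , zk) → ¬zk (subst (λ k → z k ≡ true) (marks-unique id o (marks-mark k)) zk)))

  -- Products of colours and limits on a half-line.

  module Products {E : Set} {n} (c : Word E → ℤ → ℤ → Fin n) (add : Additive c) where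

    -- The semigroup product as a relation between colours, restricted to products that occur in
    -- some word. By additivity the third colour is determined by the first two.
    Mul : Fin n → Fin n → Fin n → Set
    Mul a b d = ∃[ w ] ∃[ i ] ∃[ j ] ∃[ k ] (i ≤ j × j ≤ k) × c w i j ≡ a × c w j k ≡ b × c w i k ≡ d

    mul-intro : ∀ {w i j k} → i ≤ j → j ≤ k → Mul (c w i j) (c w j k) (c w i k)
    mul-intro p q = _ , _ , _ , _ , (p , q) , refl , refl , refl

    mul-elim : ∀ {w i j k d} → i ≤ j → j ≤ k → Mul (c w i j) (c w j k) d → c w i k ≡ d
    mul-elim p q (_ , _ , _ , _ , (p′ , q′) , e , f , refl) = add p q p′ q′ (sym e) (sym f)

  bounded : ∀ {n} (f : Fin n → ℤ) → ∃[ m ] ∀ a → f a ≤ m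
  bounded {zero}  f = 0ℤ , λ ()
  bounded {suc n} f with bounded (f ∘ suc)
  ... | m , p = f zero ℤ.⊔ m , λ where
    zero    → ℤ.i≤i⊔j (f zero) m
    (suc a) → ≤-trans (p a) (ℤ.i≤j⊔i (f zero) m)

  module Limits {E : Set} {n} (c : Word E → ℤ → ℤ → Fin n) (add : Additive c) where

    -- By additivity, the equality at m persists at every later point.
    Merge : Word E → ℤ → ℤ → Set
    Merge w k x = ∃[ m ] x ≤ m × c w k m ≡ c w x m

    Recurs : Word E → ℤ → Fin n → Set
    Recurs w k e = ∀ l → k ≤ l → ∃[ x ] l ≤ x × c w k x ≡ e × Merge w k x

    Limit : Fin n → Fin n → Word E → ℤ → Set
    Limit s e w j = ∃[ k ] j ≤ k × c w j k ≡ s × Recurs w k e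

    -- Otherwise each point fails to merge with anything beyond some bound, which yields `suc n`
    -- points no two of which merge. Seen from a common later `m`, two of them have equal colours by
    -- the pigeonhole principle, so they do merge.
    merge-often : ∀ w j → ∃[ k ] j ≤ k × ∀ l → k ≤ l → ∃[ x ] l ≤ x × Merge w k x
    merge-often w j = dne λ never →
      let (f , _ , apart) = scatter (λ k j≤k → dne λ unb → never (k , j≤k , λ l k≤l → dne λ none →
                              unb (l , k≤l , λ x l≤x mg → none (x , l≤x , mg)))) (suc n) j ≤-refl
          (m , f≤m)       = bounded f
          (a , b , a<b , e) = pigeonhole (ℕ.≤-refl) (λ a → c w (f a) m)
      in apart a b a<b (m , f≤m b , e)
      where
      scatter : (∀ k → j ≤ k → ∃[ l ] k ≤ l × ∀ x → l ≤ x → ¬ Merge w k x) →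
        ∀ r i → j ≤ i → Σ[ f ∈ (Fin r → ℤ) ] (∀ a → i ≤ f a) ×
          (∀ a b → a Fin.< b → ¬ Merge w (f a) (f b))
      scatter bound zero    i j≤i = (λ ()) , (λ ()) , λ ()
      scatter bound (suc r) i j≤i with bound i j≤i
      ... | l , i≤l , far with scatter bound r l (≤-trans j≤i i≤l)
      ...   | f , l≤f , apart = g , i≤g , apart′
        where
        g : Fin (suc r) → ℤ
        g zero    = i
        g (suc a) = f a

        i≤g : ∀ a → i ≤ g a
        i≤g zero    = ≤-refl
        i≤g (suc a) = ≤-trans i≤l (l≤f a)

        apart′ : ∀ a b → a Fin.< b → ¬ Merge w (g a) (g b)
        apart′ zero    (suc b) _           = far (f b) (l≤f b)
        apart′ (suc a) (suc b) (ℕ.s≤s a<b) = apart a b a<b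

    -- Take `k` merging with cofinally many points. If every colour were rare among them, a merging
    -- point beyond all the bounds would have no possible colour.
    limit-exists : ∀ w j → ∃[ s ] ∃[ e ] Limit s e w j
    limit-exists w j with merge-often w j
    ... | k , j≤k , often with recurring
      where
      recurring : ∃[ e ] Recurs w k e
      recurring = dne λ none →
        let rare : ∀ e → ∃[ l ] k ≤ l × ∀ x → l ≤ x → ¬ (c w k x ≡ e × Merge w k x)
            rare e = dne λ ¬rare → none (e , λ l k≤l → dne λ ¬x →
              ¬rare (l , k≤l , λ x l≤x h → ¬x (x , l≤x , h)))
            (m , l≤m)       = bounded (proj₁ ∘ rare)
            (x , m⊔k≤x , mg) = often (k ℤ.⊔ m) (ℤ.i≤i⊔j k m)
        in proj₂ (proj₂ (rare (c w k x))) x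
             (≤-trans (l≤m _) (≤-trans (ℤ.i≤j⊔i k m) m⊔k≤x)) (refl , mg)
    ...   | e , rec = c w j k , e , k , j≤k , refl , rec

    shape : Fin n → Fin n → ℕ → Fin n
    shape s e zero    = s
    shape s e (suc _) = e

    -- The first block may be empty; strictness of all later ones makes the blocks exhaust the
    -- half-line.
    record Factorisation (s e : Fin n) (w : Word E) (j : ℤ) : Set where
      field
        pos    : ℕ → ℤ
        start  : pos 0 ≡ j
        weak   : pos 0 ≤ pos 1
        strict : ∀ m → pos (suc m) < pos (suc (suc m))
        colour : ∀ m → c w (pos m) (pos (suc m)) ≡ shape s e m

      pos-mono : ∀ m → pos m ≤ pos (suc m)
      pos-mono zero    = weak
      pos-mono (suc m) = <⇒≤ (strict m)

      pos-covers : ∀ {x} → j ≤ x → ∃[ m ] pos m ≤ x × x < pos (suc m)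
      pos-covers = ≤-ind (λ x → ∃[ m ] pos m ≤ x × x < pos (suc m)) base step
        where
        base : ∃[ m ] pos m ≤ j × j < pos (suc m)
        base with j <? pos 1
        ... | yes p = 0 , ≤-reflexive start , p
        ... | no ¬p = 1 , ≮⇒≥ ¬p , ≤-<-trans (subst (_≤ pos 1) start weak) (strict 0)

        step : ∀ {x} → j ≤ x → ∃[ m ] pos m ≤ x × x < pos (suc m) →
               ∃[ m ] pos m ≤ x ⁺ × x ⁺ < pos (suc m)
        step {x} _ (m , p , q) with x ⁺ <? pos (suc m)
        ... | yes r = m , ≤-trans p i≤i⁺ , r
        ... | no ¬r = suc m , ≮⇒≥ ¬r , ≤-<-trans (<⇒⁺≤ q) (strict m)

    -- The next block starts beyond the point where k and the current position
    -- have merged, so it has the colour of the block from k.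
    limit⇒factorisation : ∀ {s e w j} → Limit s e w j → Factorisation s e w j
    limit⇒factorisation {s} {e} {w} {j} (k , j≤k , eq , rec) = record
      { pos    = pos
      ; start  = refl
      ; weak   = j≤k
      ; strict = λ m → proj₁ (next-step (state m))
      ; colour = λ { zero → eq ; (suc m) → proj₂ (next-step (state m)) }
      }
      where
      State : Set
      State = ∃[ x ] k ≤ x × Merge w k x

      next : State → State
      next (x , k≤x , m , x≤m , _) =
        let k≤m⁺ = ≤-trans k≤x (≤-trans x≤m i≤i⁺)
            (y , m⁺≤y , _ , mg) = rec (m ⁺) k≤m⁺
        in y , ≤-trans k≤m⁺ m⁺≤y , mg

      next-step : (S : State) → proj₁ S < proj₁ (next S) × c w (proj₁ S) (proj₁ (next S)) ≡ e
      next-step (x , k≤x , m , x≤m , h) =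
        let k≤m⁺ = ≤-trans k≤x (≤-trans x≤m i≤i⁺)
            (y , m⁺≤y , f , _) = rec (m ⁺) k≤m⁺
            m≤y = ≤-trans i≤i⁺ m⁺≤y
        in <-≤-trans (≤-<-trans x≤m i<i⁺) m⁺≤y ,
           trans (sym (add (≤-trans k≤x x≤m) m≤y x≤m m≤y h refl)) f

      state : ℕ → State
      state zero    = k , ≤-refl , k , ≤-refl , refl
      state (suc m) = next (state m)

      pos : ℕ → ℤ
      pos zero    = j
      pos (suc m) = proj₁ (state m)

  -- Closure properties of definable interval properties.

  module Definability (V : Set) where

    Property : Set₁
    Property = Model V → ℤ → ℤ → Set

    Definable : Property → Set₁
    Definable P = ∃[ A ] (∀ σ {i j} → i ≤ j → σ ⟨ i ⋯ j ⟩⊨ A ⇔ P σ i j)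

    definable-⇔ : ∀ {P Q : Property} → Definable P → (∀ σ {i j} → i ≤ j → P σ i j ⇔ Q σ i j) → Definable Q
    definable-⇔ (A , a) eq = A , λ σ p →
      mk⇔ (to (eq σ p) ∘ to (a σ p)) (from (a σ p) ∘ from (eq σ p))

    definable-¬ : ∀ {P} → Definable P → Definable (λ σ i j → ¬ P σ i j)
    definable-¬ (A , a) = A ⊃ ⊥′ , λ σ p →
      mk⇔ (λ { (inj₁ ¬x) → ¬x ∘ from (a σ p) ; (inj₂ ()) }) (λ ¬x → inj₁ (¬x ∘ to (a σ p)))

    -- Excluded middle chooses between truth and falsity. This turns facts about colours, such as
    -- `Mul a b d`, into formulas.
    definable-const : (P : Set) → Definable (λ _ _ _ → P)
    definable-const P with em {P}
    ... | yes p = ⊥′ ⊃ ⊥′ , λ _ _ → mk⇔ (λ _ → p) (λ _ → inj₁ id)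
    ... | no ¬p = ⊥′ , λ _ _ → mk⇔ (λ ()) ¬p

    definable-⊎ : ∀ {P Q} → Definable P → Definable Q → Definable (λ σ i j → P σ i j ⊎ Q σ i j)
    definable-⊎ {P} (A , a) (B , b) = (A ⊃ ⊥′) ⊃ B , λ σ {i} {j} p → mk⇔
      (λ where
        (inj₁ ¬¬x) → inj₁ (to (a σ p) (dne (¬¬x ∘ inj₁)))
        (inj₂ y)   → inj₂ (to (b σ p) y))
      (λ where
        (inj₁ x) → inj₁ λ { (inj₁ ¬x) → ¬x (from (a σ p) x) }
        (inj₂ y) → inj₂ (from (b σ p) y))

    definable-× : ∀ {P Q} → Definable P → Definable Q → Definable (λ σ i j → P σ i j × Q σ i j)
    definable-× {P} {Q} dP dQ = definable-⇔ (definable-¬ (definable-⊎ (definable-¬ dP) (definable-¬ dQ)))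
      λ σ p → mk⇔ (λ h → dne (h ∘ inj₁) , dne (h ∘ inj₂))
        (λ { (x , y) (inj₁ ¬x) → ¬x x ; (x , y) (inj₂ ¬y) → ¬y y })

    definable-∃ : ∀ {n} {P : Fin n → Property} → (∀ a → Definable (P a)) →
      Definable (λ σ i j → ∃[ a ] P a σ i j)
    definable-∃ {zero}  dP = definable-⇔ (definable-const ⊥) λ _ _ → mk⇔ (λ ()) (λ ())
    definable-∃ {suc n} {P} dP = definable-⇔ (definable-⊎ (dP zero) (definable-∃ (dP ∘ suc)))
      λ σ _ → mk⇔ (λ { (inj₁ x) → zero , x ; (inj₂ (a , x)) → suc a , x })
        (λ { (zero , x) → inj₁ x ; (suc a , x) → inj₂ (a , x) })

    definable-⨟ : ∀ {P Q} → Definable P → Definable Q →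
      Definable (λ σ i j → ∃[ k ] (i ≤ k × k ≤ j) × P σ i k × Q σ k j)
    definable-⨟ (A , a) (B , b) = A ⨟ B , λ σ _ → mk⇔
      (λ (k , (p , q) , x , y) → k , (p , q) , to (a σ p) x , to (b σ q) y)
      (λ (k , (p , q) , x , y) → k , (p , q) , from (a σ p) x , from (b σ q) y)

    star-map : ∀ {P Q : ℤ → ℤ → Set} → (∀ {i j} → i < j → P i j → Q i j) → ∀ {i j} → Star P i j → Star Q i j
    star-map f nil           = nil
    star-map f (cons lt p s) = cons lt (f lt p) (star-map f s)

    definable-star : ∀ {P} → Definable P → Definable (λ σ → Star (P σ))
    definable-star (A , a) = A ✶ , λ σ _ → mk⇔
      (star-map (λ lt → to (a σ (<⇒≤ lt))) ∘ to (⊨✶ σ A))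
      (from (⊨✶ σ A) ∘ star-map (λ lt → from (a σ (<⇒≤ lt))))

    definable-after : ∀ {P} → Definable P → Definable (λ σ i j → ∃[ k ] j ≤ k × P σ j k)
    definable-after (A , a) = ◇ᵣ A , λ σ _ → mk⇔
      (λ (k , p , x) → k , p , to (a σ p) x) (λ (k , p , x) → k , p , from (a σ p) x)

    definable-before : ∀ {P} → Definable P → Definable (λ σ i j → ∃[ k ] k ≤ i × P σ k i)
    definable-before (A , a) = ◇ₗ A , λ σ _ → mk⇔
      (λ (k , p , x) → k , p , to (a σ p) x) (λ (k , p , x) → k , p , from (a σ p) x)

    definable-var : ∀ q → Definable (λ σ i _ → σ i q)
    definable-var q = var q , λ _ _ → mk⇔ id id

    definable-< : Definable (λ _ i j → i < j)
    definable-< = ○ (⊥′ ⊃ ⊥′) , λ _ _ → mk⇔ proj₁ (λ p → p , inj₁ id)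

    definable-≡ : Definable (λ _ i j → i ≡ j)
    definable-≡ = definable-⇔ (definable-¬ definable-<) λ _ p → mk⇔
      (λ i≮j → ≤-antisym p (≮⇒≥ i≮j)) (λ { refl → <-irrefl refl })

    -- Length one: a first step is possible and a second one is not.
    definable-unit : Definable (λ _ i j → j ≡ i ⁺)
    definable-unit = definable-⇔ (definable-× definable-<
        (definable-¬ (○ ○ (⊥′ ⊃ ⊥′) , λ _ _ → mk⇔ (λ (p , q , _) → p , q) (λ (p , q) → p , q , inj₁ id))))
      λ _ {i} _ → mk⇔
        (λ (p , h) → ≤-antisym (≮⇒≥ λ i⁺<j → h (p , i⁺<j)) (<⇒⁺≤ p))
        (λ { refl → i<i⁺ , λ (_ , q) → <-irrefl refl q })

    -- Kleene's algorithm for the colour of an interval.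

    module Kleene {E n} (word : Model V → Word E) (C : Colouring E n)
      (letters : ∀ d → Definable (λ σ i _ → col C (word σ) i (i ⁺) ≡ d)) where

      open Products (col C) (col-add C)

      -- Runs of the automaton whose states are colours and which multiplies by the colour of each
      -- letter. The bound `K` restricts the intermediate states only, not `a` and `b`.
      data Run (w : Word E) (K : ℕ) : Fin n → Fin n → ℤ → ℤ → Set where
        step : ∀ {a b i} → Mul a (col C w i (i ⁺)) b → Run w K a b i (i ⁺)
        cons : ∀ {a d b i j} → Mul a (col C w i (i ⁺)) d → toℕ d ℕ.< K →
               Run w K d b (i ⁺) j → Run w K a b i j

      run-< : ∀ {w K a b i j} → Run w K a b i j → i < j
      run-< (step _)     = i<i⁺
      run-< (cons _ _ r) = <-trans i<i⁺ (run-< r)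

      run-++ : ∀ {w K a d b i k j} → Run w K a d i k → toℕ d ℕ.< K → Run w K d b k j → Run w K a b i j
      run-++ (step x)      lt s = cons x lt s
      run-++ (cons x l′ r) lt s = cons x l′ (run-++ r lt s)

      run-weaken : ∀ {w K a b i j} → Run w K a b i j → Run w (suc K) a b i j
      run-weaken (step x)      = step x
      run-weaken (cons x lt r) = cons x (ℕ.m<n⇒m<1+n lt) (run-weaken r)

      module _ {w : Word E} {K : ℕ} (s : Fin n) (s≡K : toℕ s ≡ K) where

        Via : Fin n → Fin n → ℤ → ℤ → Set
        Via a b i j = ∃[ k ] (i ≤ k × k ≤ j) × Run w K a s i k ×
          ∃[ l ] (k ≤ l × l ≤ j) × Star (Run w K s s) k l × Run w K s b l j

        -- The run is cut at its intermediate visits to `s`, the one state that the larger bound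
        -- adds.
        run-split : ∀ {a b i j} → Run w (suc K) a b i j → Run w K a b i j ⊎ Via a b i j
        run-split (step x) = inj₁ (step x)
        run-split (cons {d = d} x (ℕ.s≤s d≤K) r) with run-split r | ℕ.m≤n⇒m<n∨m≡n d≤K
        ... | inj₁ r′ | inj₁ d<K = inj₁ (cons x d<K r′)
        ... | inj₂ (k , (p , q) , r₁ , rest) | inj₁ d<K =
          inj₂ (k , (≤-trans i≤i⁺ p , q) , cons x d<K r₁ , rest)
        -- The first letter already leads to `s`, so it is the initial segment by itself; the
        -- initial segment of the remaining run, if that visits `s` again, becomes a loop.
        ... | r′ | inj₂ d≡K with toℕ-injective (trans d≡K (sym s≡K))
        ...   | refl with r′
        ...     | inj₁ r₁ = inj₂ (_ , (i≤i⁺ , <⇒≤ (run-< r)) , step x ,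
          _ , (≤-refl , <⇒≤ (run-< r)) , nil , r₁)
        ...     | inj₂ (k , (p , q) , r₁ , l , (p′ , q′) , st , r₂) =
          inj₂ (_ , (i≤i⁺ , <⇒≤ (run-< r)) , step x ,
            l , (≤-trans p p′ , q′) , cons (run-< r₁) r₁ st , r₂)

        s<1+K : toℕ s ℕ.< suc K
        s<1+K = ℕ.s≤s (ℕ.≤-reflexive s≡K)

        run-join : ∀ {a b i j} → Run w K a b i j ⊎ Via a b i j → Run w (suc K) a b i j
        run-join (inj₁ r) = run-weaken r
        run-join (inj₂ (k , _ , r₁ , l , _ , st , r₂)) = run-++ (run-weaken r₁) s<1+K (loop st)
          where
          loop : ∀ {k} → Star (Run w K s s) k l → Run w (suc K) s _ k _
          loop nil          = run-weaken r₂
          loop (cons _ r t) = run-++ (run-weaken r) s<1+K (loop t)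

      -- Kleene's recursion: either avoid the state numbered `K`, or go to it, loop there and leave.
      -- With bound zero only single letters can be read.
      definable-run : ∀ K → K ℕ.≤ n → ∀ a b → Definable (λ σ → Run (word σ) K a b)
      definable-run zero _ a b = definable-⇔
        (definable-× definable-unit
          (definable-∃ λ d → definable-× (letters d) (definable-const (Mul a d b))))
        λ σ _ → mk⇔ (λ { (refl , d , refl , x) → step x })
                    (λ { (step x) → refl , _ , refl , x ; (cons _ () _) })
      definable-run (suc K) K<n a b = definable-⇔
        (definable-⊎ (rec a b) (definable-⨟ (rec a s) (definable-⨟ (definable-star (rec s s)) (rec s b))))
        λ σ _ → mk⇔ (run-join s (toℕ-fromℕ< K<n)) (run-split s (toℕ-fromℕ< K<n))
        where
        s = fromℕ< K<n
        rec = definable-run K (ℕ.<⇒≤ K<n)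

      -- The state is the colour of the part [h, i) read so far; keeping `h` fixed lets the
      -- induction move along the run.
      run-sound : ∀ {w a b h i j} → h ≤ i → col C w h i ≡ a → Run w n a b i j → col C w h j ≡ b
      run-sound h≤i refl (step x)     = mul-elim h≤i i≤i⁺ x
      run-sound h≤i refl (cons x _ r) = run-sound (≤-trans h≤i i≤i⁺) (mul-elim h≤i i≤i⁺ x) r

      run-complete : ∀ {w i j} → i < j → Run w n (col C w i i) (col C w i j) i j
      run-complete {w} {i} i<j = ≤-ind (λ j → Run w n (col C w i i) (col C w i j) i j)
        (step (mul-intro ≤-refl i≤i⁺))
        (λ i⁺≤j r → run-++ r (toℕ<n _) (step (mul-intro (≤-trans i≤i⁺ i⁺≤j) i≤i⁺)))
        (<⇒⁺≤ i<j)

      definable-colour : ∀ d → Definable (λ σ i j → col C (word σ) i j ≡ d)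
      definable-colour d = definable-⇔
        (definable-⊎ (definable-× definable-≡ (definable-const (ε ≡ d))) (definable-run n ℕ.≤-refl ε d))
        λ σ {i} {j} i≤j → mk⇔
          (λ where
            (inj₁ (refl , e)) → trans (col-empty C i 0ℤ) e
            (inj₂ r)          → run-sound ≤-refl (col-empty C i 0ℤ) r)
          (λ e → case <-cmp i j of λ where
            (tri< i<j _ _)  → inj₂ (subst₂ (λ a b → Run (word σ) n a b i j) (col-empty C i 0ℤ) e (run-complete i<j))
            (tri≈ _ refl _) → inj₁ (refl , trans (col-empty C 0ℤ i) e)
            (tri> _ _ j<i)  → ⊥-elim (<⇒≱ j<i i≤j))
        where
        ε : Fin n
        -- All empty intervals have one colour, so any word and position can represent it. Runs are
        -- nonempty, hence the separate case i = j above.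
        ε = col C (word (λ _ _ → ⊥)) 0ℤ 0ℤ

    -- Definability of limits in both directions.

    -- Reading intervals through (α , β) treats future and past uniformly: the
    -- past is the future of the line reflected by k ↦ - k.
    module Oriented (α β : ℤ → ℤ → ℤ) (α≤β : ∀ {i j} → i ≤ j → α i j ≤ β i j)
      (ahead : ∀ (P : Property) → Definable (λ σ i j → P σ (α i j) (β i j)) →
        Definable (λ σ i j → ∃[ k ] β i j ≤ k × P σ (β i j) k))
      {E n} (word : Model V → Word E) (c : Word E → ℤ → ℤ → Fin n) (add : Additive c)
      (colours : ∀ d → Definable (λ σ i j → c (word σ) (α i j) (β i j) ≡ d)) where

      open Products c add
      open Limits c add

      -- If [k, x) has colour e and [x, m) has colour t, then k and x merge at m iff e t = t. This
      -- expresses merging without mentioning k.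
      Closing : Fin n → Property
      Closing e σ _ x = ∃[ m ] x ≤ m × ∃[ t ] c (word σ) x m ≡ t × Mul e t t

      -- Looking ahead forgets the start of the current interval. The point x is therefore described
      -- by the consecutive intervals [k, l), [l, x), [x, m), with a finite guess of colours linking
      -- them.
      Return : Fin n → Property
      Return e σ k l = ∃[ g ] ∃[ h ] c (word σ) k l ≡ g × Mul g h e ×
        ∃[ x ] l ≤ x × c (word σ) l x ≡ h × Closing e σ l x

      D : Property → Set₁
      D P = Definable (λ σ i j → P σ (α i j) (β i j))

      return-correct : ∀ {e σ k l} → k ≤ l →
        Return e σ k l ⇔ (∃[ x ] l ≤ x × c (word σ) k x ≡ e × Merge (word σ) k x)
      return-correct {e} {σ} {k} {l} k≤l = mk⇔ forth back
        where
        w = word σ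

        forth : Return e σ k l → ∃[ x ] l ≤ x × c w k x ≡ e × Merge w k x
        forth (_ , _ , refl , gh , x , l≤x , refl , m , x≤m , _ , refl , et) =
          x , l≤x , kx , m , x≤m ,
          mul-elim k≤x x≤m (subst (λ e → Mul e _ _) (sym kx) et)
          where
          k≤x = ≤-trans k≤l l≤x
          kx  = mul-elim k≤l l≤x gh

        back : ∃[ x ] l ≤ x × c w k x ≡ e × Merge w k x → Return e σ k l
        back (x , l≤x , refl , m , x≤m , eq) = _ , _ , refl , mul-intro k≤l l≤x , x , l≤x , refl ,
          m , x≤m , _ , refl , subst (Mul _ _) eq (mul-intro (≤-trans k≤l l≤x) x≤m)

      definable-return : ∀ e → D (Return e)
      definable-return e = definable-∃ λ g → definable-∃ λ h →
        definable-× (colours g) (definable-× (definable-const (Mul g h e))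
          (ahead (λ σ l x → c (word σ) l x ≡ h × Closing e σ l x) (definable-× (colours h)
            (ahead (λ σ x m → ∃[ t ] c (word σ) x m ≡ t × Mul e t t)
              (definable-∃ λ t → definable-× (colours t) (definable-const (Mul e t t)))))))

      definable-recurs : ∀ e → D (λ σ _ k → Recurs (word σ) k e)
      definable-recurs e = definable-⇔ (definable-¬
          (ahead (λ σ k l → ¬ Return e σ k l) (definable-¬ (definable-return e))))
        λ σ _ → mk⇔
          (λ h l k≤l → to (return-correct {σ = σ} k≤l) (dne λ ¬r → h (l , k≤l , ¬r)))
          (λ rec (l , k≤l , ¬r) → ¬r (from (return-correct {σ = σ} k≤l) (rec l k≤l)))

      definable-limit : ∀ s e → D (λ σ _ j → Limit s e (word σ) j)
      definable-limit s e = ahead (λ σ j k → c (word σ) j k ≡ s × Recurs (word σ) k e)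
        (definable-× (colours s) (definable-recurs e))

    -- From regular languages to formulas.

    module Final {E : Set} (word : Model V → Word E)
      (letters : (S : E → Set) → Definable (λ σ i j → S (word σ i))) where

      marked : Word E → ℤ → ℤ → Word ((E × Bool) × Bool)
      marked w i j = w ▹ mark i ▹ mark j

      module _ {n} (C : Colouring ((E × Bool) × Bool) n) where

        -- Both marks are constant before i, on [i, j) and from j on; fixing their values turns `C`
        -- into a colouring of unmarked words.
        layer : Bool → Bool → Colouring E n
        layer x y = record
          { col        = λ w → col C (λ k → (w k , x) , y)
          ; col-empty  = col-empty C
          ; col-letter = λ e → col-letter C (cong (λ a → (a , x) , y) e)
          ; col-add    = col-add C
          }

        definable-layer : ∀ x y d → Definable (λ σ i j → col (layer x y) (word σ) i j ≡ d)
        definable-layer x y = Kleene.definable-colour word (layer x y) λ d →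
          -- The colour of a letter can be read off from the constant word of that letter.
          definable-⇔ (letters (λ a → col (layer x y) (λ _ → a) 0ℤ (0ℤ ⁺) ≡ d)) λ σ _ → mk⇔
            (trans (col-letter (layer x y) refl)) (trans (col-letter (layer x y) refl))

        -- `before` lives on the reflected line, where the past of i is the future of `- i`.
        before after between : Word E → ℤ → ℤ → Fin n
        before w a b = col (layer false false) w (- b) (- a)
        between      = col (layer true false)
        after        = col (layer true true)

        before-add : Additive before
        before-add p q p′ q′ e f = col-add (layer false false)
          (ℤ.neg-mono-≤ q) (ℤ.neg-mono-≤ p) (ℤ.neg-mono-≤ q′) (ℤ.neg-mono-≤ p′) f e

        module Past   = Limits before before-add
        module Future = Limits after (col-add (layer true true))

        definable-past : ∀ s e → Definable (λ σ i _ → Past.Limit s e (word σ) (- i))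
        definable-past = Oriented.definable-limit (λ i j → - j) (λ i j → - i) ℤ.neg-mono-≤ ahead
          word before before-add
          λ d → definable-⇔ (definable-layer false false d) λ σ {i} {j} _ →
            subst₂ (λ a b → col (layer false false) (word σ) i j ≡ d ⇔ col (layer false false) (word σ) a b ≡ d)
              (sym (ℤ.neg-involutive i)) (sym (ℤ.neg-involutive j)) (mk⇔ id id)
          where
          ahead : ∀ P → Definable (λ σ i j → P σ (- j) (- i)) →
            Definable (λ σ i j → ∃[ k ] - i ≤ k × P σ (- i) k)
          ahead P dP = definable-⇔ (definable-before dP) λ σ {i} _ → mk⇔
            (λ (k , k≤i , x) → - k , ℤ.neg-mono-≤ k≤i , x)
            (λ (k , -i≤k , x) → - k , subst (- k ≤_) (ℤ.neg-involutive i) (ℤ.neg-mono-≤ -i≤k) ,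
              subst (P σ (- i)) (sym (ℤ.neg-involutive k)) x)

        definable-future : ∀ s e → Definable (λ σ _ j → Future.Limit s e (word σ) j)
        definable-future = Oriented.definable-limit (λ i j → i) (λ i j → j) id
          (λ P → definable-after) word after (col-add (layer true true)) (definable-layer true true)

        Typed : Word E → ℤ → ℤ → (s′ e′ d s e : Fin n) → Set
        Typed w i j s′ e′ d s e = Past.Limit s′ e′ w (- i) × between w i j ≡ d × Future.Limit s e w j

        -- Block -1 is [i, j); blocks 0, 1, ... factorise the future of j, and blocks -2, -3, ...
        -- the past of i read backwards.
        colours : (s′ e′ d s e : Fin n) → ℤ → Fin n
        colours s′ e′ d s e (+ m)          = Future.shape s e m
        colours s′ e′ d s e -[1+ zero ]    = d
        colours s′ e′ d s e -[1+ suc m ]   = Past.shape s′ e′ m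

        mark-true : ∀ {i k} → i ≤ k → mark i k ≡ true
        mark-true = from ⟦⟧-true

        mark-false : ∀ {i k} → k < i → mark i k ≡ false
        mark-false {i} {k} k<i with em {i ≤ k}
        ... | yes i≤k = ⊥-elim (<⇒≱ k<i i≤k)
        ... | no _    = refl

        cut-up : ∀ {w i j s′ e′ d s e} → i ≤ j → Typed w i j s′ e′ d s e →
          ∃[ k ] Cuts k × (∀ m → col C (marked w i j) (k m) (k (sucℤ m)) ≡ colours s′ e′ d s e m)
        cut-up {w} {i} {j} {s′} {e′} {d} {s} {e} i≤j (past , eq , future) =
          k , record { mono = k-mono ; covers = k-covers } , k-colour
          where
          module P = Past.Factorisation (Past.limit⇒factorisation past)
          module F = Future.Factorisation (Future.limit⇒factorisation future)

          k : ℤ → ℤ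
          k (+ m)    = F.pos m
          k -[1+ m ] = - P.pos m

          k₋₁≡i : k -[1+ 0 ] ≡ i
          k₋₁≡i = trans (cong -_ P.start) (ℤ.neg-involutive i)

          k₋₁≤k₀ : k -[1+ 0 ] ≤ k (+ 0)
          k₋₁≤k₀ = subst₂ _≤_ (sym k₋₁≡i) (sym F.start) i≤j

          k-mono : ∀ m → k m ≤ k (sucℤ m)
          k-mono (+ m)        = F.pos-mono m
          k-mono -[1+ zero ]  = k₋₁≤k₀
          k-mono -[1+ suc m ] = ℤ.neg-mono-≤ (P.pos-mono m)

          k-covers : ∀ x → ∃[ m ] k m ≤ x × x < k (sucℤ m)
          k-covers x with x <? i | x <? j
          ... | _       | no x≮j  = let (m , p , q) = F.pos-covers (≮⇒≥ x≮j) in + m , p , q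
          ... | no x≮i  | yes x<j =
            -[1+ 0 ] , subst (_≤ x) (sym k₋₁≡i) (≮⇒≥ x≮i) , subst (x <_) (sym F.start) x<j
          ... | yes x<i | yes _   =
            -- Reflection exchanges open and closed ends of blocks; looking up the predecessor of
            -- `- x` corrects this.
            let (m , p , q) = P.pos-covers (ℤ.i<j⇒i≤pred[j] (ℤ.neg-mono-< x<i))
            in -[1+ suc m ] ,
               subst (- P.pos (suc m) ≤_) (ℤ.neg-involutive x) (ℤ.neg-mono-≤ (-x≤ q)) ,
               subst (_< - P.pos m) (ℤ.neg-involutive x) (ℤ.neg-mono-< (ℤ.i≤pred[j]⇒i<j p))
            where
            -x≤ : ∀ {a b} → ℤ.pred a < b → a ≤ b
            -x≤ p = ≮⇒≥ λ b<a → <⇒≱ p (ℤ.i<j⇒i≤pred[j] b<a)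

          after-j : ∀ m → j ≤ F.pos m
          after-j zero    = ≤-reflexive (sym F.start)
          after-j (suc m) = ≤-trans (after-j m) (F.pos-mono m)

          before-i : ∀ m → - P.pos m ≤ i
          before-i zero    = ≤-reflexive k₋₁≡i
          before-i (suc m) = ≤-trans (ℤ.neg-mono-≤ (P.pos-mono m)) (before-i m)

          marks : ∀ {x a b} → mark i x ≡ a → mark j x ≡ b → marked w i j x ≡ ((w x , a) , b)
          marks refl refl = refl

          -- No block crosses a mark, so on each block the marked word agrees with the word that its
          -- layer colours.
          k-colour : ∀ m → col C (marked w i j) (k m) (k (sucℤ m)) ≡ colours s′ e′ d s e m
          k-colour (+ m) = trans
            (col-local C (F.pos-mono m) λ x p _ → let j≤x = ≤-trans (after-j m) p in
              marks (mark-true (≤-trans i≤j j≤x)) (mark-true j≤x))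
            (F.colour m)
          k-colour -[1+ zero ] = trans
            (col-local C k₋₁≤k₀ λ x p q →
              marks (mark-true (subst (_≤ x) k₋₁≡i p)) (mark-false (subst (x <_) F.start q)))
            (trans (cong₂ (between w) k₋₁≡i F.start) eq)
          k-colour -[1+ suc m ] = trans
            (col-local C (ℤ.neg-mono-≤ (P.pos-mono m)) λ x _ q → let x<i = <-≤-trans q (before-i m) in
              marks (mark-false x<i) (mark-false (<-≤-trans x<i i≤j)))
            (P.colour m)

        -- The type alone determines the colours of all blocks.
        typed-≈ : ∀ {w v i j i′ j′ s′ e′ d s e} → i ≤ j → i′ ≤ j′ →
          Typed w i j s′ e′ d s e → Typed v i′ j′ s′ e′ d s e → marked w i j ≈[ C ] marked v i′ j′
        typed-≈ p q t u =
          let (_ , K , f) = cut-up p t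
              (_ , L , g) = cut-up q u
          in match K L (λ m → trans (f m) (sym (g m)))

      -- There are finitely many types. The formula is the disjunction of those realised by a marked
      -- word in `L`: invariance of `L` gives soundness, and existence of limits gives every marked
      -- word a type.
      regular⇒definable : ∀ {L} → Regular L → Definable (λ σ i j → L (marked (word σ) i j))
      regular⇒definable {L} R = definable-⇔ definable-accepted λ σ i≤j → mk⇔ (sound i≤j) (complete i≤j)
        where
        C = colouring R

        Accepted : (s′ e′ d s e : Fin (size R)) → Set
        Accepted s′ e′ d s e =
          ∃[ w ] ∃[ i ] ∃[ j ] i ≤ j × Typed C w i j s′ e′ d s e × L (marked w i j)

        Recognised : Word E → ℤ → ℤ → Set
        Recognised w i j = ∃[ s′ ] ∃[ e′ ] ∃[ d ] ∃[ s ] ∃[ e ]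
          Accepted s′ e′ d s e × Typed C w i j s′ e′ d s e

        definable-accepted : Definable (λ σ → Recognised (word σ))
        definable-accepted =
          definable-∃ λ s′ → definable-∃ λ e′ → definable-∃ λ d → definable-∃ λ s → definable-∃ λ e →
          definable-× (definable-const (Accepted s′ e′ d s e))
            (definable-× (definable-past C s′ e′)
              (definable-× (definable-layer C true false d) (definable-future C s e)))

        sound : ∀ {w i j} → i ≤ j → Recognised w i j → L (marked w i j)
        sound i≤j (_ , _ , _ , _ , _ , (_ , _ , _ , p , t , l) , u) = resp R (typed-≈ C p i≤j t u) l

        complete : ∀ {w i j} → i ≤ j → L (marked w i j) → Recognised w i j
        complete {w} {i} {j} i≤j l =
          let (s′ , e′ , past)  = Past.limit-exists C w (- i)
              (s , e , future) = Future.limit-exists C w j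
              t                = past , refl , future
          in s′ , e′ , _ , s , e , (w , i , j , i≤j , t , l) , t

    -- Letters over finitely many variables and elimination of the quantifier.

    vars : Formula V → List V
    vars ⊥′      = []
    vars (var q) = q ∷ []
    vars (A ⊃ B) = vars A ++ vars B
    vars (○ A)   = vars A
    vars (A ⨟ B) = vars A ++ vars B
    vars (A ✶)   = vars A
    vars (◇ₗ A)  = vars A
    vars (◇ᵣ A)  = vars A

    -- Allows letters to record the finitely many variables of `A` only, although `V` may be
    -- infinite.
    ⊨-cong : ∀ A {σ τ : Model V} → (∀ k {q} → q ∈ vars A → σ k q ⇔ τ k q) →
      ∀ {i j} → σ ⟨ i ⋯ j ⟩⊨ A → τ ⟨ i ⋯ j ⟩⊨ A
    ⊨-cong (var q) eq x = to (eq _ (here refl)) x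
    ⊨-cong (A ⊃ B) eq (inj₁ ¬a) = inj₁ (¬a ∘ ⊨-cong A (λ k q∈ → mk⇔ (from (eq k (∈-++⁺ˡ q∈))) (to (eq k (∈-++⁺ˡ q∈)))))
    ⊨-cong (A ⊃ B) eq (inj₂ b) = inj₂ (⊨-cong B (λ k q∈ → eq k (∈-++⁺ʳ (vars A) q∈)) b)
    ⊨-cong (○ A) eq (p , a) = p , ⊨-cong A eq a
    ⊨-cong (A ⨟ B) eq (k , p , a , b) =
      k , p , ⊨-cong A (λ k q∈ → eq k (∈-++⁺ˡ q∈)) a , ⊨-cong B (λ k q∈ → eq k (∈-++⁺ʳ (vars A) q∈)) b
    ⊨-cong (A ✶) {σ} {τ} eq s = from (⊨✶ τ A) (star-map (λ _ → ⊨-cong A eq) (to (⊨✶ σ A) s))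
    ⊨-cong (◇ₗ A) eq (k , p , a) = k , p , ⊨-cong A eq a
    ⊨-cong (◇ᵣ A) eq (k , p , a) = k , p , ⊨-cong A eq a

    letter : List V → (V → Set) → List Bool
    letter qs s = map (λ q → ⟦ s q ⟧) qs

    -- A case distinction on each variable in turn leaves a constant proposition.
    definable-letter : (qs : List V) (S : List Bool → Set) →
      Definable (λ σ i _ → S (letter qs (σ i)))
    definable-letter []       S = definable-const (S [])
    definable-letter (q ∷ qs) S = definable-⇔
      (definable-⊎ (definable-× (definable-var q) (definable-letter qs (λ u → S (true ∷ u))))
                   (definable-× (definable-¬ (definable-var q)) (definable-letter qs (λ u → S (false ∷ u)))))
      λ σ {i} _ → ⟦⟧-cases {σ i q} (λ b → S (b ∷ letter qs (σ i)))

    -- Lookup by membership. Repetitions in `qs` are harmless, because a `letter` gives equal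
    -- variables equal truth values.
    Reads : List V → List Bool → V → Set
    Reads qs bs q = (q , true) ∈ zip qs bs

    reads-letter : ∀ {qs q} s → q ∈ qs → Reads qs (letter qs s) q ⇔ s q
    reads-letter {qs} s q∈qs = mk⇔ (sound qs) (complete q∈qs)
      where
      sound : ∀ qs {q} → Reads qs (letter qs s) q → s q
      sound (q ∷ qs) (here eq) = subst s (sym (cong proj₁ eq)) (to ⟦⟧-true (sym (cong proj₂ eq)))
      sound (q ∷ qs) (there r) = sound qs r

      complete : ∀ {qs q} → q ∈ qs → s q → Reads qs (letter qs s) q
      complete (here refl) x = here (cong (_ ,_) (sym (from ⟦⟧-true x)))
      complete (there q∈)  x = there (complete q∈ x)

    -- The quantifier over `p` becomes the projection of a Boolean track: `val` reads `p` from that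
    -- track and all other variables from the letter.
    projection : ∀ A p → ∃[ A′ ] ((σ : Model V) (i j : ℤ) → i ≤ j → σ ⟨ i ⋯ j ⟩⊨ A′ ⇔ σ ⟨ i ⋯ j ⟩⊨∃[ p ] A)
    projection A p = proj₁ definable , λ σ i j i≤j → mk⇔
      (forth σ ∘ to (proj₂ definable σ i≤j)) (from (proj₂ definable σ i≤j) ∘ back σ i≤j)
      where
      qs = vars A

      word : Model V → Word (List Bool)
      word σ k = letter qs (σ k)

      open Final word (definable-letter qs)

      Letter : Set
      Letter = ((List Bool × Bool) × Bool) × Bool

      val : Letter → V → Set
      val (((u , _) , _) , b) q = p ≡ q × b ≡ true ⊎ p ≢ q × Reads qs u q

      X Y : Letter → Bool
      X (((_ , x) , _) , _) = x
      Y (((_ , _) , y) , _) = y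

      L : Word ((List Bool × Bool) × Bool) → Set
      L w = ∃[ b ] Holds val X Y A (w ▹ b)

      definable : Definable (λ σ i j → L (marked (word σ) i j))
      definable = regular⇒definable (regular-∃ (regular-holds A val X Y))

      forth : ∀ σ {i j} → L (marked (word σ) i j) → σ ⟨ i ⋯ j ⟩⊨∃[ p ] A
      forth σ {i} {j} (b , i′ , j′ , _ , m , n , a)
        with marks-unique id {mark i} m (marks-mark i) | marks-unique id {mark j} n (marks-mark j)
      ... | refl | refl = σ′ ,
        (λ k → (λ (x , p≢q) → inj₂ (p≢q , x) , p≢q) ,
               (λ { (inj₁ (p≡q , _) , p≢q) → ⊥-elim (p≢q p≡q) ; (inj₂ (_ , x) , p≢q) → x , p≢q })) ,
        ⊨-cong A agree a
        where
        σ′ : Model V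
        -- Values other than those of `p` come from `σ` and not from the letters, so variables
        -- outside `vars A` are preserved too.
        σ′ k q = p ≡ q × b k ≡ true ⊎ p ≢ q × σ k q

        agree : ∀ k {q} → q ∈ qs → val ((marked (word σ) i j ▹ b) k) q ⇔ σ′ k q
        agree k q∈ = mk⇔ (map₂ λ (p≢q , r) → p≢q , to (reads-letter (σ k) q∈) r)
                         (map₂ λ (p≢q , x) → p≢q , from (reads-letter (σ k) q∈) x)

      back : ∀ σ {i j} → i ≤ j → σ ⟨ i ⋯ j ⟩⊨∃[ p ] A → L (marked (word σ) i j)
      back σ {i} {j} i≤j (σ′ , same , a) = b ,
        i , j , i≤j , marks-mark i , marks-mark j , ⊨-cong A agree a
        where
        b : Word Bool
        b k = ⟦ σ′ k p ⟧

        agree : ∀ k {q} → q ∈ qs → σ′ k q ⇔ val ((marked (word σ) i j ▹ b) k) q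
        agree k {q} q∈ = mk⇔
          (λ x → case em {p ≡ q} of λ where
            (yes refl) → inj₁ (refl , from ⟦⟧-true x)
            (no p≢q)   → inj₂ (p≢q , from (reads-letter (σ k) q∈) (proj₁ (proj₂ (same k) (x , p≢q)))))
          (λ where
            (inj₁ (refl , bk)) → to ⟦⟧-true bk
            (inj₂ (p≢q , r))   → proj₁ (proj₁ (same k) (to (reads-letter (σ k) q∈) r , p≢q)))

theorem14 : ExcludedMiddle 0ℓ →
    (V : Set) (A : Formula V) (p : V) →
    ∃[ A′ ] ((σ : Model V) (i j : ℤ) → i ≤ j →
    σ ⟨ i ⋯ j ⟩⊨ A′ ⇔ σ ⟨ i ⋯ j ⟩⊨∃[ p ] A)
theorem14 em V = Classical.Definability.projection em V
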